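{- Let $H$ be a uniquely vector colorable graph whose unique optimal vector coloring $i\mapsto p_i$ is injective. Then any connected graph $G$ with $H\subseteq G\subseteq H'(p)$ (all on vertex set $V(H)$) is a core.
   Context: A vector $t$-coloring of a graph ($t\ge2$) assigns unit vectors $p_i\in\mathbb{R}^d$ to vertices with $\langle p_i,p_j\rangle\le-1/(t-1)$ for all edges $ij$; $\chi_v$ is the least such $t$, and optimal means $t=\chi_v$. A graph is uniquely vector colorable if any two of its optimal vector colorings have the same Gram matrix. $H'(p)$ is the graph on $V(H)$ in which distinct $u,v$ are adjacent iff $\langle p_u,p_v\rangle\le-1/(\chi_v(H)-1)$. A graph $G$ is a core if every homomorphism (adjacency-preserving map) $G\to G$ is an automorphism. -}

module Defs where

open import Data.Fin using (Fin)
open import Data.Nat as ℕ using (ℕ)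
import Data.Nat.Properties as ℕ
open import Data.Product using (Σ; ∃; _×_; _,_; proj₁; proj₂)
open import Data.Rational as ℚ using (ℚ; 0ℚ; 1ℚ; ½; ∣_∣)
open import Data.Vec.Functional using (Vector; foldr; zipWith)
open import Function.Bundles using (_⇔_)
open import Function.Definitions using (Bijective)
open import Relation.Binary.Construct.Closure.ReflexiveTransitive using (Star)
open import Relation.Binary.PropositionalEquality
  using (_≡_; _≢_; refl; sym; trans; cong; cong₂; subst; subst₂)
open import Relation.Nullary using (¬_; yes; no; contradiction)

module RationalEstimates where

  open import Data.Rational using (_+_; _*_; _-_; -_; 1/_; _≤_; _<_; NonZero; NonNegative; Positive)
  open import Data.Rational.Properties
  open import Data.Rational.Solver using (module +-*-Solver)
  open +-*-Solver using (solve; con; _:+_; _:*_; :-_; _:-_; _:=_)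

  -- The total inverse with inv 0 = 0.
  inv : ℚ → ℚ
  inv q with q ≟ 0ℚ
  ... | yes _  = 0ℚ
  ... | no q≢0 = (1/ q) {{ℚ.≢-nonZero q≢0}}

  abstract

    inv-inverseʳ : ∀ q → 0ℚ < q → q * inv q ≡ 1ℚ
    inv-inverseʳ q 0<q with q ≟ 0ℚ
    ... | yes q≡0 = contradiction (sym q≡0) (<⇒≢ 0<q)
    ... | no q≢0  = *-inverseʳ q {{ℚ.≢-nonZero q≢0}}

    inv-pos : ∀ q → 0ℚ < q → 0ℚ < inv q
    inv-pos q 0<q with q ≟ 0ℚ
    ... | yes q≡0 = contradiction (sym q≡0) (<⇒≢ 0<q)
    ... | no q≢0  = positive⁻¹ _ {{1/pos⇒pos q {{ℚ.positive 0<q}}}}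

    *-pos : ∀ {p q} → 0ℚ < p → 0ℚ < q → 0ℚ < p * q
    *-pos {p} {q} 0<p 0<q =
      positive⁻¹ _ {{pos*pos⇒pos p {{ℚ.positive 0<p}} q {{ℚ.positive 0<q}}}}

    *-mono-≤ : ∀ {p q r s} → 0ℚ ≤ r → 0ℚ ≤ q → p ≤ q → r ≤ s → p * r ≤ q * s
    *-mono-≤ {p} {q} {r} {s} 0≤r 0≤q p≤q r≤s = ≤-trans
      (*-monoʳ-≤-nonNeg r {{ℚ.nonNegative 0≤r}} p≤q)
      (*-monoˡ-≤-nonNeg q {{ℚ.nonNegative 0≤q}} r≤s)

    half-pos : ∀ {ε} → 0ℚ < ε → 0ℚ < ε * ½
    half-pos 0<ε = *-pos 0<ε (positive⁻¹ ½)

    half+half : ∀ ε → ε * ½ + ε * ½ ≡ ε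
    half+half ε = trans (sym (*-distribˡ-+ ε ½ ½)) (*-identityʳ ε)

    ∣p-p∣≤ : ∀ p {ε} → 0ℚ < ε → ∣ p - p ∣ ≤ ε
    ∣p-p∣≤ p 0<ε = subst (_≤ _) (sym (cong ∣_∣ (+-inverseʳ p))) (<⇒≤ 0<ε)

    +-estimate : ∀ a b c d {ε} → ∣ a - c ∣ ≤ ε * ½ → ∣ b - d ∣ ≤ ε * ½ →
                 ∣ (a + b) - (c + d) ∣ ≤ ε
    +-estimate a b c d {ε} ac bd = subst₂ _≤_
      (cong ∣_∣ (solve 4 (λ a b c d → (a :- c) :+ (b :- d) := (a :+ b) :- (c :+ d)) refl a b c d))
      (half+half ε)
      (≤-trans (∣p+q∣≤∣p∣+∣q∣ (a - c) (b - d)) (+-mono-≤ ac bd))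

    neg-estimate : ∀ a b {ε} → ∣ a - b ∣ ≤ ε → ∣ (- a) - (- b) ∣ ≤ ε
    neg-estimate a b = subst (_≤ _)
      (trans (sym (∣-p∣≡∣p∣ (a - b)))
             (cong ∣_∣ (solve 2 (λ a b → :- (a :- b) := (:- a) :- (:- b)) refl a b)))

    bound-estimate : ∀ a b → ∣ a - b ∣ ≤ 1ℚ → ∣ a ∣ ≤ ∣ b ∣ + 1ℚ
    bound-estimate a b ab = subst (_≤ ∣ b ∣ + 1ℚ)
      (cong ∣_∣ (solve 2 (λ a b → b :+ (a :- b) := a) refl a b))
      (≤-trans (∣p+q∣≤∣p∣+∣q∣ b (a - b)) (+-monoʳ-≤ ∣ b ∣ ab))

    bound-pos : ∀ b → 0ℚ < ∣ b ∣ + 1ℚ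
    bound-pos b = +-mono-≤-< (0≤∣p∣ b) (positive⁻¹ 1ℚ)

    B*[ε*inv[B]]≡ε : ∀ {B} ε → 0ℚ < B → B * (ε * inv B) ≡ ε
    B*[ε*inv[B]]≡ε {B} ε 0<B = trans
      (solve 3 (λ B ε i → B :* (ε :* i) := ε :* (B :* i)) refl B ε (inv B))
      (trans (cong (ε *_) (inv-inverseʳ B 0<B)) (*-identityʳ ε))

    *-estimate : ∀ a b c d {A D ε} → 0ℚ < A → 0ℚ < D → ∣ a ∣ ≤ A → ∣ d ∣ ≤ D →
                 ∣ b - d ∣ ≤ (ε * ½) * inv A → ∣ a - c ∣ ≤ (ε * ½) * inv D →
                 ∣ a * b - c * d ∣ ≤ ε
    *-estimate a b c d {A} {D} {ε} 0<A 0<D aA dD bd ac = subst₂ _≤_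
      (cong ∣_∣ (solve 4 (λ a b c d → a :* (b :- d) :+ d :* (a :- c) := a :* b :- c :* d) refl a b c d))
      (trans (cong₂ _+_ (B*[ε*inv[B]]≡ε (ε * ½) 0<A) (B*[ε*inv[B]]≡ε (ε * ½) 0<D)) (half+half ε))
      (≤-trans (∣p+q∣≤∣p∣+∣q∣ (a * (b - d)) (d * (a - c)))
        (+-mono-≤ (product a (b - d) 0<A aA bd) (product d (a - c) 0<D dD ac)))
      where
      product : ∀ p q {P Q} → 0ℚ < P → ∣ p ∣ ≤ P → ∣ q ∣ ≤ Q → ∣ p * q ∣ ≤ P * Q
      product p q 0<P pP qQ = subst (_≤ _) (sym (∣p*q∣≡∣p∣*∣q∣ p q))
        (*-mono-≤ (0≤∣p∣ q) (<⇒≤ 0<P) pP qQ)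

    inv-estimate : ∀ a b {δ ε} → 0ℚ < δ → 0ℚ < ε → δ ≤ a → δ ≤ b →
                   ∣ a - b ∣ ≤ ε * (δ * δ) → ∣ inv a - inv b ∣ ≤ ε
    inv-estimate a b {δ} {ε} 0<δ 0<ε δ≤a δ≤b ab = subst (_≤ ε) (sym ∣eq∣)
      (≤-trans (*-monoʳ-≤-nonNeg (i * j) {{ℚ.nonNegative (<⇒≤ (*-pos 0<i 0<j))}} ab)
      (≤-trans (≤-reflexive (solve 4 (λ ε δ i j → (ε :* (δ :* δ)) :* (i :* j) := ε :* ((δ :* i) :* (δ :* j))) refl ε δ i j))
      (≤-trans (*-monoˡ-≤-nonNeg ε {{ℚ.nonNegative (<⇒≤ 0<ε)}}
                 (*-mono-≤ (<⇒≤ (*-pos 0<δ 0<j)) (<⇒≤ (positive⁻¹ 1ℚ))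
                   (≤one 0<a 0<i δ≤a) (≤one 0<b 0<j δ≤b)))
               (≤-reflexive (trans (cong (ε *_) (*-identityʳ 1ℚ)) (*-identityʳ ε))))))
      where
      i : ℚ
      i = inv a
      j : ℚ
      j = inv b
      0<a : 0ℚ < a
      0<a = <-≤-trans 0<δ δ≤a
      0<b : 0ℚ < b
      0<b = <-≤-trans 0<δ δ≤b
      0<i : 0ℚ < i
      0<i = inv-pos a 0<a
      0<j : 0ℚ < j
      0<j = inv-pos b 0<b
      ≤one : ∀ {c} → 0ℚ < c → 0ℚ < inv c → δ ≤ c → δ * inv c ≤ 1ℚ
      ≤one {c} 0<c 0<k δ≤c = subst (δ * inv c ≤_) (inv-inverseʳ c 0<c)
        (*-monoʳ-≤-nonNeg (inv c) {{ℚ.nonNegative (<⇒≤ 0<k)}} δ≤c)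
      eq : (b - a) * (i * j) ≡ i - j
      eq = trans
        (solve 4 (λ a b i j → (b :- a) :* (i :* j) := i :* (b :* j) :- j :* (a :* i)) refl a b i j)
        (trans (cong₂ (λ u v → i * u - j * v) (inv-inverseʳ b 0<b) (inv-inverseʳ a 0<a))
               (cong₂ _-_ (*-identityʳ i) (*-identityʳ j)))
      ∣b-a∣≡∣a-b∣ : ∣ b - a ∣ ≡ ∣ a - b ∣
      ∣b-a∣≡∣a-b∣ = trans (cong ∣_∣ (solve 2 (λ a b → b :- a := :- (a :- b)) refl a b)) (∣-p∣≡∣p∣ (a - b))
      ∣eq∣ : ∣ i - j ∣ ≡ ∣ a - b ∣ * (i * j)
      ∣eq∣ = trans (cong ∣_∣ (sym eq)) (trans (∣p*q∣≡∣p∣*∣q∣ (b - a) (i * j))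
        (cong₂ _*_ ∣b-a∣≡∣a-b∣ (0≤p⇒∣p∣≡p (<⇒≤ (*-pos 0<i 0<j)))))

    1≤-estimate : ∀ a → (1ℚ + 1ℚ) ≤ a + ½ → 0ℚ + ½ ≤ a + (- 1ℚ)
    1≤-estimate a h = subst (0ℚ + ½ ≤_)
      (solve 1 (λ a → (a :+ con ½) :+ con (- (1ℚ + ½)) := a :+ con (- 1ℚ)) refl a)
      (+-monoˡ-≤ (- (1ℚ + ½)) h)

open RationalEstimates

-- Real numbers are Cauchy sequences of rationals, with no prescribed rate of
-- convergence, compared by _≈_: "the difference tends to 0".

Eventually : (ℕ → Set) → Set
Eventually P = ∃ λ N → ∀ n → N ℕ.≤ n → P n

IsCauchy : (ℕ → ℚ) → Set
IsCauchy x = ∀ ε → 0ℚ ℚ.< ε →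
  ∃ λ N → ∀ m n → N ℕ.≤ m → N ℕ.≤ n → ∣ x m ℚ.- x n ∣ ℚ.≤ ε

record ℝ : Set where
  constructor real
  field
    seq    : ℕ → ℚ
    cauchy : IsCauchy seq

open ℝ public

infix  4 _≈_ _≤_ _<_
infixl 6 _+_ _-_
infixl 7 _*_
infix  8 -_

_≈_ : ℝ → ℝ → Set
x ≈ y = ∀ ε → 0ℚ ℚ.< ε → Eventually λ n → ∣ seq x n ℚ.- seq y n ∣ ℚ.≤ ε

_≤_ : ℝ → ℝ → Set
x ≤ y = ∀ ε → 0ℚ ℚ.< ε → Eventually λ n → seq x n ℚ.≤ seq y n ℚ.+ ε

_<_ : ℝ → ℝ → Set
x < y = ∃ λ ε → 0ℚ ℚ.< ε × Eventually λ n → seq x n ℚ.+ ε ℚ.≤ seq y n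

fromℚ : ℚ → ℝ
fromℚ q = real (λ _ → q) λ ε 0<ε → 0 , λ _ _ _ _ → ∣p-p∣≤ q 0<ε

0ℝ 1ℝ 2ℝ : ℝ
0ℝ = fromℚ 0ℚ
1ℝ = fromℚ 1ℚ
2ℝ = fromℚ (1ℚ ℚ.+ 1ℚ)

_+_ : ℝ → ℝ → ℝ
x + y = real (λ n → seq x n ℚ.+ seq y n) λ ε 0<ε →
  let (M , hx) = cauchy x (ε ℚ.* ½) (half-pos 0<ε)
      (N , hy) = cauchy y (ε ℚ.* ½) (half-pos 0<ε)
  in M ℕ.⊔ N , λ m n m≥ n≥ → +-estimate (seq x m) (seq y m) (seq x n) (seq y n)
       (hx m n (ℕ.m⊔n≤o⇒m≤o M N m≥) (ℕ.m⊔n≤o⇒m≤o M N n≥))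
       (hy m n (ℕ.m⊔n≤o⇒n≤o M N m≥) (ℕ.m⊔n≤o⇒n≤o M N n≥))

-_ : ℝ → ℝ
- x = real (λ n → ℚ.- seq x n) λ ε 0<ε →
  let (N , h) = cauchy x ε 0<ε
  in N , λ m n m≥ n≥ → neg-estimate (seq x m) (seq x n) (h m n m≥ n≥)

_-_ : ℝ → ℝ → ℝ
x - y = x + (- y)

bounded : ∀ x → ∃ λ B → 0ℚ ℚ.< B × Eventually λ n → ∣ seq x n ∣ ℚ.≤ B
bounded x =
  let (N , h) = cauchy x 1ℚ (ℚ.positive⁻¹ 1ℚ)
  in ∣ seq x N ∣ ℚ.+ 1ℚ , bound-pos (seq x N) ,
     N , λ n n≥ → bound-estimate (seq x n) (seq x N) (h n N n≥ ℕ.≤-refl)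
  where import Data.Rational.Properties as ℚ

_*_ : ℝ → ℝ → ℝ
x * y = real (λ n → seq x n ℚ.* seq y n) λ ε 0<ε →
  let (A , 0<A , K , bx) = bounded x
      (D , 0<D , L , by) = bounded y
      (M , hy) = cauchy y (ε ℚ.* ½ ℚ.* inv A) (*-pos (half-pos 0<ε) (inv-pos A 0<A))
      (N , hx) = cauchy x (ε ℚ.* ½ ℚ.* inv D) (*-pos (half-pos 0<ε) (inv-pos D 0<D))
      k = K ℕ.⊔ L
      l = M ℕ.⊔ N
  in k ℕ.⊔ l , λ m n m≥ n≥ →
       let m≥k = ℕ.m⊔n≤o⇒m≤o k l m≥
           n≥k = ℕ.m⊔n≤o⇒m≤o k l n≥
           m≥l = ℕ.m⊔n≤o⇒n≤o k l m≥
           n≥l = ℕ.m⊔n≤o⇒n≤o k l n≥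
       in *-estimate (seq x m) (seq y m) (seq x n) (seq y n) 0<A 0<D
            (bx m (ℕ.m⊔n≤o⇒m≤o K L m≥k)) (by n (ℕ.m⊔n≤o⇒n≤o K L n≥k))
            (hy m n (ℕ.m⊔n≤o⇒m≤o M N m≥l) (ℕ.m⊔n≤o⇒m≤o M N n≥l))
            (hx m n (ℕ.m⊔n≤o⇒n≤o M N m≥l) (ℕ.m⊔n≤o⇒n≤o M N n≥l))

recip : (x : ℝ) → 0ℝ < x → ℝ
recip x (δ , 0<δ , M , x≥δ) = real (λ n → inv (seq x n)) λ ε 0<ε →
  let (N , h) = cauchy x (ε ℚ.* (δ ℚ.* δ)) (*-pos 0<ε (*-pos 0<δ 0<δ))
  in M ℕ.⊔ N , λ m n m≥ n≥ → inv-estimate (seq x m) (seq x n) 0<δ 0<ε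
       (δ≤ m (ℕ.m⊔n≤o⇒m≤o M N m≥)) (δ≤ n (ℕ.m⊔n≤o⇒m≤o M N n≥))
       (h m n (ℕ.m⊔n≤o⇒n≤o M N m≥) (ℕ.m⊔n≤o⇒n≤o M N n≥))
  where
  δ≤ : ∀ n → M ℕ.≤ n → δ ℚ.≤ seq x n
  δ≤ n M≤n = subst (ℚ._≤ seq x n) (+-identityˡ δ) (x≥δ n M≤n)
    where open import Data.Rational.Properties using (+-identityˡ)

recip-inverseʳ : ∀ x (0<x : 0ℝ < x) → x * recip x 0<x ≈ 1ℝ
recip-inverseʳ x (δ , 0<δ , M , x≥δ) ε 0<ε = M , λ n n≥ →
  subst (λ q → ∣ q ℚ.- 1ℚ ∣ ℚ.≤ ε)
    (sym (inv-inverseʳ (seq x n)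
      (<-≤-trans 0<δ (subst (ℚ._≤ seq x n) (+-identityˡ δ) (x≥δ n n≥)))))
    (∣p-p∣≤ 1ℚ 0<ε)
  where open import Data.Rational.Properties using (+-identityˡ; <-≤-trans)

ℝ^ : ℕ → Set
ℝ^ d = Vector ℝ d

_≋_ : ∀ {d} → ℝ^ d → ℝ^ d → Set
p ≋ q = ∀ k → p k ≈ q k

⟨_,_⟩ : ∀ {d} → ℝ^ d → ℝ^ d → ℝ
⟨ p , q ⟩ = foldr _+_ 0ℝ (zipWith _*_ p q)

IsUnit : ∀ {d} → ℝ^ d → Set
IsUnit p = ⟨ p , p ⟩ ≈ 1ℝ

-- Finite simple graphs on the vertex set Fin n.
record Graph (n : ℕ) : Set₁ where
  field
    Adj    : Fin n → Fin n → Set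
    symm   : ∀ {i j} → Adj i j → Adj j i
    irrefl : ∀ {i} → ¬ Adj i i

open Graph public

_⊆_ : ∀ {n} → Graph n → Graph n → Set
G ⊆ K = ∀ {i j} → Adj G i j → Adj K i j

Connected : ∀ {n} → Graph n → Set
Connected G = ∀ i j → Star (Adj G) i j

IsHomomorphism : ∀ {m n} → Graph m → Graph n → (Fin m → Fin n) → Set
IsHomomorphism G K f = ∀ {i j} → Adj G i j → Adj K (f i) (f j)

IsAutomorphism : ∀ {n} → Graph n → (Fin n → Fin n) → Set
IsAutomorphism G f =
  Bijective _≡_ _≡_ f × (∀ i j → Adj G i j ⇔ Adj G (f i) (f j))

IsCore : ∀ {n} → Graph n → Set
IsCore G = ∀ f → IsHomomorphism G G f → IsAutomorphism G f

ℝ≥2 : Set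
ℝ≥2 = Σ ℝ (2ℝ ≤_)

0<t-1 : ((t , _) : ℝ≥2) → 0ℝ < t - 1ℝ
0<t-1 (t , 2≤t) =
  let (N , h) = 2≤t ½ 0<½
  in ½ , 0<½ , N , λ n n≥ → 1≤-estimate (seq t n) (h n n≥)
  where
  import Data.Rational.Properties as ℚ
  0<½ = ℚ.positive⁻¹ ½

-- -1/(t - 1)
threshold : ℝ≥2 → ℝ
threshold t = - recip (proj₁ t - 1ℝ) (0<t-1 t)

IsVectorColoring : ∀ {n} → Graph n → ℝ≥2 → ∀ {d} → (Fin n → ℝ^ d) → Set
IsVectorColoring H t p =
  (∀ i → IsUnit (p i)) ×
  (∀ {i j} → Adj H i j → ⟨ p i , p j ⟩ ≤ threshold t)

VectorColorable : ∀ {n} → Graph n → ℝ≥2 → Set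
VectorColorable {n} H t = ∃ λ d → Σ (Fin n → ℝ^ d) λ p → IsVectorColoring H t p

-- χ = χᵥ(H): the least t ≥ 2 for which H has a vector t-coloring.
IsVectorChromaticNumber : ∀ {n} → Graph n → ℝ≥2 → Set
IsVectorChromaticNumber H χ =
  VectorColorable H χ × (∀ t → VectorColorable H t → proj₁ χ ≤ proj₁ t)

IsOptimalVectorColoring : ∀ {n} → Graph n → ∀ {d} → (Fin n → ℝ^ d) → Set
IsOptimalVectorColoring H p =
  ∃ λ χ → IsVectorChromaticNumber H χ × IsVectorColoring H χ p

-- The two colorings may live in different dimensions.
UniquelyVectorColorable : ∀ {n} → Graph n → Set
UniquelyVectorColorable {n} H =
  ∀ {d e} (p : Fin n → ℝ^ d) (q : Fin n → ℝ^ e) →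
  IsOptimalVectorColoring H p → IsOptimalVectorColoring H q →
  ∀ i j → ⟨ p i , p j ⟩ ≈ ⟨ q i , q j ⟩

⟨⟩-comm : ∀ {d} (p q : ℝ^ d) n → seq ⟨ p , q ⟩ n ≡ seq ⟨ q , p ⟩ n
⟨⟩-comm {ℕ.zero}  p q n = refl
⟨⟩-comm {ℕ.suc d} p q n = cong₂ ℚ._+_
  (ℚ.*-comm (seq (p Fin.zero) n) (seq (q Fin.zero) n))
  (⟨⟩-comm (λ k → p (Fin.suc k)) (λ k → q (Fin.suc k)) n)
  where import Data.Rational.Properties as ℚ

-- H′(p) depends on H only through χ = χᵥ(H).
H′ : ∀ {n} → ℝ≥2 → ∀ {d} → (Fin n → ℝ^ d) → Graph n
H′ χ p = record
  { Adj    = λ i j → i ≢ j × ⟨ p i , p j ⟩ ≤ threshold χ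
  ; symm   = λ {i} {j} (i≢j , h) → (λ j≡i → i≢j (sym j≡i)) , λ ε 0<ε →
      let (N , h′) = h ε 0<ε
      in N , λ n n≥ → subst (ℚ._≤ _) (⟨⟩-comm (p i) (p j) n) (h′ n n≥)
  ; irrefl = λ (i≢i , _) → i≢i refl
  }

{-# OPTIONS --safe #-}

-- Let f be an endomorphism of G. Since G ⊆ H′(p), p ∘ f is again an optimal
-- vector coloring of H, so by uniqueness it has the Gram matrix of p. If
-- f i = f j then ⟨pᵢ,pⱼ⟩ = 1, i.e. |pᵢ - pⱼ|² = 0, and i = j. Thus f is a
-- permutation of a finite set; since some positive power of f fixes any two
-- given vertices, f is onto and reflects adjacency.

module Submission where

open import Defs
open import Data.Fin as Fin using (Fin; combine; toℕ)
open import Data.Fin.Properties using (combine-injective; pigeonhole)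
open import Data.Nat as ℕ using (ℕ; zero; suc)
open import Data.Nat.GeneralisedArithmetic using (fold; fold-+)
import Data.Nat.Properties as ℕ
open import Data.Product using (∃; _×_; _,_; proj₂)
open import Data.Rational as ℚ using (ℚ; 0ℚ; ½; ∣_∣)
import Data.Rational.Properties as ℚ
open import Data.Rational.Solver using (module +-*-Solver)
open import Data.Sum using (inj₁; inj₂)
open import Function using (_∘_)
open import Function.Bundles using (mk⇔)
open import Function.Consequences.Propositional using (strictlySurjective⇒surjective)
open import Function.Definitions using (Injective)
open import Relation.Binary.PropositionalEquality
  using (_≡_; refl; sym; trans; cong; subst; subst₂)

open +-*-Solver using (solve; :-_; _:+_; _:*_; _:-_; _:=_)
open RationalEstimates using (*-pos; half-pos; half+half; *-mono-≤)

∣p∣*∣p∣≡p*p : ∀ p → ∣ p ∣ ℚ.* ∣ p ∣ ≡ p ℚ.* p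
∣p∣*∣p∣≡p*p p with ℚ.∣p∣≡p∨∣p∣≡-p p
... | inj₁ ∣p∣≡p  = cong (λ q → q ℚ.* q) ∣p∣≡p
... | inj₂ ∣p∣≡-p = trans (cong (λ q → q ℚ.* q) ∣p∣≡-p)
  (solve 1 (λ p → (:- p) :* (:- p) := p :* p) refl p)

0≤p*p : ∀ p → 0ℚ ℚ.≤ p ℚ.* p
0≤p*p p = subst (0ℚ ℚ.≤_) (∣p∣*∣p∣≡p*p p)
  (*-mono-≤ ℚ.≤-refl (ℚ.0≤∣p∣ p) (ℚ.0≤∣p∣ p) (ℚ.0≤∣p∣ p))

-- This stands in for a square root: it turns a bound ε² on a squared coordinate difference into the
-- bound ε that `≈` asks for.
p*p≤q*q⇒∣p∣≤q : ∀ p {q} → 0ℚ ℚ.< q → p ℚ.* p ℚ.≤ q ℚ.* q → ∣ p ∣ ℚ.≤ q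
p*p≤q*q⇒∣p∣≤q p {q} 0<q pp≤qq = ℚ.≮⇒≥ λ q<∣p∣ →
  ℚ.<-irrefl refl (ℚ.<-≤-trans
    (ℚ.<-trans (ℚ.*-monoʳ-<-pos q {{ℚ.positive 0<q}} q<∣p∣)
               (ℚ.*-monoˡ-<-pos ∣ p ∣ {{ℚ.positive (ℚ.<-trans 0<q q<∣p∣)}} q<∣p∣))
    (subst (ℚ._≤ q ℚ.* q) (sym (∣p∣*∣p∣≡p*p p)) pp≤qq))

p≤∣p∣ : ∀ p → p ℚ.≤ ∣ p ∣
p≤∣p∣ p with ℚ.≤-total 0ℚ p
... | inj₁ 0≤p = ℚ.≤-reflexive (sym (ℚ.0≤p⇒∣p∣≡p 0≤p))
... | inj₂ p≤0 = ℚ.≤-trans p≤0 (ℚ.0≤∣p∣ p)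

∣p-q∣≡∣q-p∣ : ∀ p q → ∣ p ℚ.- q ∣ ≡ ∣ q ℚ.- p ∣
∣p-q∣≡∣q-p∣ p q = trans (sym (ℚ.∣-p∣≡∣p∣ (p ℚ.- q)))
  (cong ∣_∣ (solve 2 (λ p q → :- (p :- q) := q :- p) refl p q))

≈-sym : ∀ x y → x ≈ y → y ≈ x
≈-sym x y x≈y ε 0<ε = let (N , h) = x≈y ε 0<ε in
  N , λ n n≥ → subst (ℚ._≤ ε) (∣p-q∣≡∣q-p∣ (seq x n) (seq y n)) (h n n≥)

≈-trans : ∀ x y z → x ≈ y → y ≈ z → x ≈ z
≈-trans x y z x≈y y≈z ε 0<ε =
  let (M , g) = x≈y (ε ℚ.* ½) (half-pos 0<ε)
      (N , h) = y≈z (ε ℚ.* ½) (half-pos 0<ε)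
  in M ℕ.⊔ N , λ n n≥ → subst (ℚ._≤ ε)
       (cong ∣_∣ (solve 3 (λ x y z → (x :- y) :+ (y :- z) := x :- z) refl
         (seq x n) (seq y n) (seq z n)))
       (ℚ.≤-trans (ℚ.∣p+q∣≤∣p∣+∣q∣ (seq x n ℚ.- seq y n) (seq y n ℚ.- seq z n))
         (subst (_ ℚ.≤_) (half+half ε)
           (ℚ.+-mono-≤ (g n (ℕ.m⊔n≤o⇒m≤o M N n≥)) (h n (ℕ.m⊔n≤o⇒n≤o M N n≥)))))

-- The n-th term of |p - q|² = (|p|² - ⟨p,q⟩) + (|q|² - ⟨p,q⟩).
dist² : ∀ {d} → ℝ^ d → ℝ^ d → ℕ → ℚ
dist² p q n = (seq ⟨ p , p ⟩ n ℚ.- seq ⟨ p , q ⟩ n) ℚ.+ (seq ⟨ q , q ⟩ n ℚ.- seq ⟨ p , q ⟩ n)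

sqDiff : ∀ {d} → ℝ^ d → ℝ^ d → Fin d → ℕ → ℚ
sqDiff p q k n = (seq (p k) n ℚ.- seq (q k) n) ℚ.* (seq (p k) n ℚ.- seq (q k) n)

-- Each inner product unfolds to a head product plus the inner product of the tails, so this is a
-- polynomial identity between rationals. By induction `dist²` is an exact sum of squares at every
-- index.
dist²-suc : ∀ {d} (p q : ℝ^ (suc d)) n →
            dist² p q n ≡ sqDiff p q Fin.zero n ℚ.+ dist² (p ∘ Fin.suc) (q ∘ Fin.suc) n
dist²-suc p q n = solve 5
  (λ a b s t u →
    ((a :* a :+ s) :- (a :* b :+ t)) :+ ((b :* b :+ u) :- (a :* b :+ t)) :=
    (a :- b) :* (a :- b) :+ ((s :- t) :+ (u :- t)))
  refl (seq (p Fin.zero) n) (seq (q Fin.zero) n)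
  (seq ⟨ p ∘ Fin.suc , p ∘ Fin.suc ⟩ n) (seq ⟨ p ∘ Fin.suc , q ∘ Fin.suc ⟩ n)
  (seq ⟨ q ∘ Fin.suc , q ∘ Fin.suc ⟩ n)

0≤dist² : ∀ {d} (p q : ℝ^ d) n → 0ℚ ℚ.≤ dist² p q n
0≤dist² {zero}  p q n = ℚ.≤-refl
0≤dist² {suc d} p q n = subst (0ℚ ℚ.≤_) (sym (dist²-suc p q n))
  (ℚ.+-mono-≤ (0≤p*p (seq (p Fin.zero) n ℚ.- seq (q Fin.zero) n))
              (0≤dist² (p ∘ Fin.suc) (q ∘ Fin.suc) n))

sqDiff≤dist² : ∀ {d} (p q : ℝ^ d) k n → sqDiff p q k n ℚ.≤ dist² p q n
sqDiff≤dist² p q Fin.zero n = subst₂ ℚ._≤_ (ℚ.+-identityʳ _) (sym (dist²-suc p q n))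
  (ℚ.+-monoʳ-≤ (sqDiff p q Fin.zero n) (0≤dist² (p ∘ Fin.suc) (q ∘ Fin.suc) n))
sqDiff≤dist² p q (Fin.suc k) n = subst₂ ℚ._≤_ (ℚ.+-identityˡ _) (sym (dist²-suc p q n))
  (ℚ.+-mono-≤ (0≤p*p (seq (p Fin.zero) n ℚ.- seq (q Fin.zero) n))
              (sqDiff≤dist² (p ∘ Fin.suc) (q ∘ Fin.suc) k n))

-- The argument runs index by index: the hypotheses force `dist²` to tend to 0, and at each index it
-- dominates every squared coordinate difference.
⟨⟩-separates : ∀ {d} (p q : ℝ^ d) →
               ⟨ p , p ⟩ ≈ ⟨ p , q ⟩ → ⟨ q , q ⟩ ≈ ⟨ p , q ⟩ → p ≋ q
⟨⟩-separates p q pp≈pq qq≈pq k ε 0<ε =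
  let 0<εε    = *-pos 0<ε 0<ε
      -- Each of the two gaps making up `dist²` gets half of ε², so that coordinates differ by at
      -- most ε.
      (M , g) = pp≈pq (ε ℚ.* ε ℚ.* ½) (half-pos 0<εε)
      (N , h) = qq≈pq (ε ℚ.* ε ℚ.* ½) (half-pos 0<εε)
  in M ℕ.⊔ N , λ n n≥ → p*p≤q*q⇒∣p∣≤q (seq (p k) n ℚ.- seq (q k) n) 0<ε
       (ℚ.≤-trans (sqDiff≤dist² p q k n)
         (subst (dist² p q n ℚ.≤_) (half+half (ε ℚ.* ε))
           (ℚ.+-mono-≤
             (ℚ.≤-trans (p≤∣p∣ _) (g n (ℕ.m⊔n≤o⇒m≤o M N n≥)))
             (ℚ.≤-trans (p≤∣p∣ _) (h n (ℕ.m⊔n≤o⇒n≤o M N n≥))))))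

unit-⟨⟩≈1⇒≋ : ∀ {d} (p q : ℝ^ d) → IsUnit p → IsUnit q → ⟨ p , q ⟩ ≈ 1ℝ → p ≋ q
unit-⟨⟩≈1⇒≋ p q pp≈1 qq≈1 pq≈1 = ⟨⟩-separates p q
  (≈-trans ⟨ p , p ⟩ 1ℝ ⟨ p , q ⟩ pp≈1 1≈pq)
  (≈-trans ⟨ q , q ⟩ 1ℝ ⟨ p , q ⟩ qq≈1 1≈pq)
  where
  1≈pq : 1ℝ ≈ ⟨ p , q ⟩
  1≈pq = ≈-sym ⟨ p , q ⟩ 1ℝ pq≈1

module _ {A : Set} {f : A → A} where

  fold-comm : ∀ x k → fold (f x) f k ≡ f (fold x f k)
  fold-comm x zero    = refl
  fold-comm x (suc k) = cong f (fold-comm x k)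

  fold-injective : Injective _≡_ _≡_ f → ∀ k {x y} → fold x f k ≡ fold y f k → x ≡ y
  fold-injective inj zero    eq = eq
  fold-injective inj (suc k) eq = fold-injective inj k (inj eq)

  -- An injective map has injective iterates, so the first k applications of f cancel. The form
  -- `suc k ℕ.+ l` is what k < k′ supplies, and it keeps the remaining exponent positive.
  fold-cancel : Injective _≡_ _≡_ f → ∀ k l {x} →
                fold x f k ≡ fold x f (suc k ℕ.+ l) → fold x f (suc l) ≡ x
  fold-cancel inj k l {x} eq = sym (fold-injective inj k
    (trans eq (trans (cong (fold x f) (sym (ℕ.+-suc k l))) (fold-+ x f k))))

-- The pigeonhole principle is applied to the orbit of the pair (i , j), so that one exponent serves
-- both points.
injective⇒recurrent : ∀ {n} {f : Fin n → Fin n} → Injective _≡_ _≡_ f →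
                      ∀ i j → ∃ λ k → fold i f (suc k) ≡ i × fold j f (suc k) ≡ j
injective⇒recurrent {n} {f} inj i j
  -- Pairs are coded in `Fin (n ℕ.* n)`, so among n² + 1 exponents two give the same pair.
  with pigeonhole (ℕ.n<1+n (n ℕ.* n)) (λ k → combine (fold i f (toℕ k)) (fold j f (toℕ k)))
... | a , b , a<b , eq with ℕ.m≤n⇒∃[o]m+o≡n a<b
...   | l , a+l≡b =
  let (eqᵢ , eqⱼ) = combine-injective _ _ _ _ eq
  in l , fold-cancel inj (toℕ a) l (trans eqᵢ (cong (fold i f) (sym a+l≡b)))
       , fold-cancel inj (toℕ a) l (trans eqⱼ (cong (fold j f) (sym a+l≡b)))

fold-homomorphism : ∀ {n} (G : Graph n) {f} → IsHomomorphism G G f → ∀ k {i j} →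
                    Adj G i j → Adj G (fold i f k) (fold j f k)
fold-homomorphism G hom zero    e = e
fold-homomorphism G hom (suc k) e = hom (fold-homomorphism G hom k e)

injective-endomorphism⇒automorphism : ∀ {n} (G : Graph n) {f} →
  IsHomomorphism G G f → Injective _≡_ _≡_ f → IsAutomorphism G f
injective-endomorphism⇒automorphism G {f} hom inj =
  (inj , strictlySurjective⇒surjective surjective) , λ i j → mk⇔ hom (reflects i j)
  where
  surjective : ∀ j → ∃ λ i → f i ≡ j
  surjective j = let (k , eq , _) = injective⇒recurrent inj j j in fold j f k , eq

  -- If the power k + 1 of f fixes i and j, then its power k carries f i and f j back to i and j,
  -- and it preserves edges.
  reflects : ∀ i j → Adj G (f i) (f j) → Adj G i j
  reflects i j e =
    let (k , eqᵢ , eqⱼ) = injective⇒recurrent inj i j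
    in subst₂ (Adj G) (trans (fold-comm i k) eqᵢ) (trans (fold-comm j k) eqⱼ)
         (fold-homomorphism G hom k e)

theorem4p7 : (n : ℕ) (H : Graph n) →
    UniquelyVectorColorable H →
    (χ : ℝ≥2) → IsVectorChromaticNumber H χ →
    (d : ℕ) (p : Fin n → ℝ^ d) → IsVectorColoring H χ p →
    Injective _≡_ _≋_ p →
    (G : Graph n) → Connected G → H ⊆ G → G ⊆ H′ χ p →
    IsCore G
theorem4p7 n H unique χ χ-min d p (unit , edge) p-inj G _ H⊆G G⊆H′ f hom =
  injective-endomorphism⇒automorphism G hom f-inj
  where
  gram : ∀ i j → ⟨ p i , p j ⟩ ≈ ⟨ p (f i) , p (f j) ⟩
  gram = unique p (p ∘ f) (χ , χ-min , unit , edge)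
    -- An edge of H lies in G, f maps it to an edge of G, and that edge lies in `H′ χ p`, which is
    -- the required bound for `p ∘ f` with the same χ.
    (χ , χ-min , unit ∘ f , λ e → proj₂ (G⊆H′ (hom (H⊆G e))))

  f-inj : Injective _≡_ _≡_ f
  f-inj {i} {j} fi≡fj = p-inj (unit-⟨⟩≈1⇒≋ (p i) (p j) (unit i) (unit j)
    (≈-trans ⟨ p i , p j ⟩ ⟨ p (f i) , p (f j) ⟩ 1ℝ (gram i j)
      -- When f i = f j, the right-hand Gram entry is the squared norm of the unit vector p (f i).
      (subst (λ k → ⟨ p (f i) , p k ⟩ ≈ 1ℝ) fi≡fj (unit (f i)))))
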